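{- Let $G$ be a finite complete group, let $g\in G$ be an involution, let $\sigma(g)$ be the inner automorphism $h\mapsto ghg^{ -1}$, and let $S\subseteq G$ be a generalized Cayley subset of $G$ induced by $\sigma(g)$. Then for any $x\in\Omega_{\sigma(g)}(G)$, $$GC(G,S,\sigma(g))\cong GC(G,xSx,\sigma(g)),$$ where $xSx=\{xsx\mid s\in S\}$ and $\cong$ denotes graph isomorphism.
   Context: A group $G$ is complete if $Z(G)=\{e\}$ and $\mathrm{Aut}(G)=\mathrm{Inn}(G)$. An involution is an element of order $2$. For $y\in G$ and $\alpha\in\mathrm{Aut}(G)$, $y^\alpha$ denotes the image of $y$ under $\alpha$. Generalized Cayley graphs: given a finite group $G$, an automorphism $\alpha\in\mathrm{Aut}(G)$ and $S\subseteq G$, suppose (a) $\alpha^2=\mathrm{id}$; (b) for every $y\in G$, $(y^{ -1})^\alpha y\notin S$; (c) for all $y,h\in G$, if $(h^{ -1})^\alpha y\in S$ then $(y^{ -1})^\alpha h\in S$. Then $S$ is called a generalized Cayley subset of $G$ induced by $\alpha$, and $GC(G,S,\alpha)$ is the graph with vertex set $G$ and edge set $\{\{y,h\}\mid (y^{ -1})^\alpha h\in S\}$. Writing $GC(G,S,\alpha)$ includes the assertion that $S$ is a generalized Cayley subset induced by $\alpha$. $\omega_\alpha(G)=\{(y^{ -1})^\alpha y\mid y\in G\}$ and $\Omega_\alpha(G)=\{y\in G\mid y^\alpha=y^{ -1},\ y\notin\omega_\alpha(G)\}$. -}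

module Defs where

open import Algebra.Bundles using (Group)
open import Algebra.Morphism.Structures using (module GroupMorphisms)
import Algebra.Properties.Group as GroupProperties
open import Data.Fin.Base using (Fin)
open import Data.Product.Base using (_×_; _,_; ∃-syntax)
open import Function.Bundles using (Inverse; _⇔_)
open import Level using (Level; _⊔_; suc)
open import Relation.Binary.Bundles using (Setoid)
open import Relation.Binary.Core using (Rel)
open import Relation.Binary.Definitions
  using (Symmetric; Irreflexive; _Respects_; _Respects₂_)
open import Relation.Binary.PropositionalEquality.Properties using (setoid)
import Relation.Binary.Reasoning.Setoid as SetoidReasoning
open import Relation.Nullary.Negation.Core using (¬_)
open import Relation.Unary using (Pred)

------------------------------------------------------------------------
-- Simple graphs

-- `Adj u v` says that the unordered pair {u, v} is an edge.
record Graph (v ℓ e : Level) : Set (suc (v ⊔ ℓ ⊔ e)) where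
  field
    vertices   : Setoid v ℓ
  open Setoid vertices public using () renaming (Carrier to Vertex; _≈_ to _≈ᵛ_)
  field
    Adj        : Rel Vertex e
    Adj-resp   : Adj Respects₂ _≈ᵛ_
    Adj-sym    : Symmetric Adj
    Adj-irrefl : Irreflexive _≈ᵛ_ Adj

infix 4 _≅_

record _≅_ {v₁ ℓ₁ e₁ v₂ ℓ₂ e₂}
           (Γ₁ : Graph v₁ ℓ₁ e₁) (Γ₂ : Graph v₂ ℓ₂ e₂)
           : Set (v₁ ⊔ ℓ₁ ⊔ e₁ ⊔ v₂ ⊔ ℓ₂ ⊔ e₂) where
  private
    module Γ₁ = Graph Γ₁
    module Γ₂ = Graph Γ₂
  field
    bijection : Inverse Γ₁.vertices Γ₂.vertices
  open Inverse bijection public using (to)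
  field
    Adj⇔      : ∀ u v → Γ₁.Adj u v ⇔ Γ₂.Adj (to u) (to v)

------------------------------------------------------------------------
-- Groups

module _ {c ℓ} (G : Group c ℓ) where

  open Group G hiding (setoid)
  open GroupMorphisms rawGroup rawGroup using (IsGroupIsomorphism)

  IsFinite : Set (c ⊔ ℓ)
  IsFinite = ∃[ n ] Inverse (Group.setoid G) (setoid (Fin n))

  IsInvolution : Carrier → Set ℓ
  IsInvolution g = ¬ (g ≈ ε) × g ∙ g ≈ ε

  -- Elements are compared by _≈_, so membership has to respect it.
  record Subset (p : Level) : Set (c ⊔ ℓ ⊔ suc p) where
    field
      Member : Pred Carrier p
      resp   : Member Respects _≈_

  record Automorphism : Set (c ⊔ ℓ) where
    field
      ⟦_⟧                : Carrier → Carrier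
      isGroupIsomorphism : IsGroupIsomorphism ⟦_⟧
    open IsGroupIsomorphism isGroupIsomorphism public

module _ {c ℓ} {G : Group c ℓ} where

  open Group G

  infix 4 _∈_ _∉_
  infixl 9 _^_

  _∈_ : ∀ {p} → Carrier → Subset G p → Set p
  x ∈ A = Subset.Member A x

  _∉_ : ∀ {p} → Carrier → Subset G p → Set p
  x ∉ A = ¬ (x ∈ A)

  _^_ : Carrier → Automorphism G → Carrier
  y ^ α = Automorphism.⟦_⟧ α y

module _ {c ℓ} (G : Group c ℓ) where

  open Group G hiding (setoid)
  open GroupProperties G
  open SetoidReasoning (Group.setoid G)

  σ : Carrier → Automorphism G
  σ g = record
    { ⟦_⟧ = conj
    ; isGroupIsomorphism = record
      { isGroupMonomorphism = record
        { isGroupHomomorphism = record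
          { isMonoidHomomorphism = record
            { isMagmaHomomorphism = record
              { isRelHomomorphism = record { cong = conj-cong }
              ; homo = conj-homo
              }
            ; ε-homo = conj-ε
            }
          ; ⁻¹-homo = λ h → inverseˡ-unique _ _ (begin
              conj (h ⁻¹) ∙ conj h  ≈⟨ conj-homo (h ⁻¹) h ⟨
              conj (h ⁻¹ ∙ h)       ≈⟨ conj-cong (inverseˡ h) ⟩
              conj ε                ≈⟨ conj-ε ⟩
              ε                     ∎)
          }
        ; injective = λ eq → ∙-cancelˡ g _ _ (∙-cancelʳ (g ⁻¹) _ _ eq)
        }
      ; surjective = λ y → g ⁻¹ ∙ y ∙ g , λ {z} z≈ → begin
          g ∙ z ∙ g ⁻¹                 ≈⟨ conj-cong z≈ ⟩
          g ∙ (g ⁻¹ ∙ y ∙ g) ∙ g ⁻¹    ≈⟨ ∙-congʳ (∙-congˡ (assoc (g ⁻¹) y g)) ⟩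
          g ∙ (g ⁻¹ ∙ (y ∙ g)) ∙ g ⁻¹  ≈⟨ ∙-congʳ (\\-leftDividesˡ g (y ∙ g)) ⟩
          y ∙ g ∙ g ⁻¹                 ≈⟨ //-rightDividesʳ g y ⟩
          y                            ∎
      }
    }
    where
    conj : Carrier → Carrier
    conj h = g ∙ h ∙ g ⁻¹

    conj-cong : ∀ {h k} → h ≈ k → conj h ≈ conj k
    conj-cong h≈k = ∙-congʳ (∙-congˡ h≈k)

    conj-homo : ∀ h k → conj (h ∙ k) ≈ conj h ∙ conj k
    conj-homo h k = begin
      g ∙ (h ∙ k) ∙ g ⁻¹                ≈⟨ ∙-congʳ (assoc g h k) ⟨
      g ∙ h ∙ k ∙ g ⁻¹                  ≈⟨ assoc (g ∙ h) k (g ⁻¹) ⟩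
      g ∙ h ∙ (k ∙ g ⁻¹)                ≈⟨ ∙-congˡ (\\-leftDividesʳ g (k ∙ g ⁻¹)) ⟨
      g ∙ h ∙ (g ⁻¹ ∙ (g ∙ (k ∙ g ⁻¹))) ≈⟨ assoc (g ∙ h) (g ⁻¹) (g ∙ (k ∙ g ⁻¹)) ⟨
      conj h ∙ (g ∙ (k ∙ g ⁻¹))         ≈⟨ ∙-congˡ (assoc g k (g ⁻¹)) ⟨
      conj h ∙ conj k                   ∎

    conj-ε : conj ε ≈ ε
    conj-ε = trans (∙-congʳ (identityʳ g)) (inverseʳ g)

  -- Z(G) = {e} and Aut(G) ⊆ Inn(G); the inclusion Inn(G) ⊆ Aut(G) is the type of σ.
  IsComplete : Set (c ⊔ ℓ)
  IsComplete = (∀ z → (∀ h → z ∙ h ≈ h ∙ z) → z ≈ ε)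
             × ((α : Automorphism G) → ∃[ a ] (∀ h → h ^ α ≈ h ^ σ a))

  module _ (α : Automorphism G) where

    open Automorphism α using (⟦⟧-cong)

    ω : Subset G (c ⊔ ℓ)
    ω = record
      { Member = λ z → ∃[ y ] z ≈ (y ⁻¹) ^ α ∙ y
      ; resp   = λ z≈w (y , z≈) → y , trans (sym z≈w) z≈
      }

    Ω : Subset G (c ⊔ ℓ)
    Ω = record
      { Member = λ y → y ^ α ≈ y ⁻¹ × y ∉ ω
      ; resp   = λ y≈z (yα≈ , y∉ω) →
            trans (⟦⟧-cong (sym y≈z)) (trans yα≈ (⁻¹-cong y≈z))
          , λ z∈ω → y∉ω (Subset.resp ω (sym y≈z) z∈ω)
      }

  -- The subset x S x, with x on both sides: not a conjugate of S.
  twoSided : ∀ {p} → Carrier → Subset G p → Subset G (c ⊔ ℓ ⊔ p)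
  twoSided x S = record
    { Member = λ t → ∃[ s ] s ∈ S × t ≈ x ∙ s ∙ x
    ; resp   = λ t≈u (s , s∈S , t≈) → s , s∈S , trans (sym t≈u) t≈
    }

  record IsGeneralizedCayley {p} (S : Subset G p) (α : Automorphism G)
                             : Set (c ⊔ ℓ ⊔ p) where
    field
      α²≈id     : ∀ y → y ^ α ^ α ≈ y
      loopless  : ∀ y → (y ⁻¹) ^ α ∙ y ∉ S
      symmetric : ∀ y h → (h ⁻¹) ^ α ∙ y ∈ S → (y ⁻¹) ^ α ∙ h ∈ S

  GC : ∀ {p} (S : Subset G p) (α : Automorphism G) →
       IsGeneralizedCayley S α → Graph c ℓ p
  GC S α isGC = record
    { vertices   = Group.setoid G
    ; Adj        = λ y h → (y ⁻¹) ^ α ∙ h ∈ S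
    ; Adj-resp   = (λ h≈k → resp (∙-congˡ h≈k))
                 , (λ y≈z → resp (∙-congʳ (⟦⟧-cong (⁻¹-cong y≈z))))
    ; Adj-sym    = λ {y} {h} → symmetric h y
    ; Adj-irrefl = λ {y} y≈h yh∈S → loopless y (resp (∙-congˡ (sym y≈h)) yh∈S)
    }
    where
    open Subset S using (resp)
    open Automorphism α using (⟦⟧-cong)
    open IsGeneralizedCayley isGC

{-# OPTIONS --safe #-}

-- Write α = σ(g).  Since x^α = x⁻¹, right translation by x satisfies
--   ((y x)⁻¹)^α (h x) = x ((y⁻¹)^α h) x,
-- so y ↦ y x is an isomorphism.  The conditions on x S x are those on S
-- transported along it.

module Submission where

open import Defs
open import Algebra.Bundles using (Group)
import Algebra.Properties.Group as GroupProperties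
open import Data.Product.Base using (Σ-syntax; _,_; proj₁)
open import Function.Bundles using (Inverse; mk⇔)
import Relation.Binary.Reasoning.Setoid as SetoidReasoning

module _ {c ℓ} (G : Group c ℓ) where

  open Group G
  open GroupProperties G
  open SetoidReasoning (Group.setoid G)

  rightTranslation : Carrier → Inverse (Group.setoid G) (Group.setoid G)
  rightTranslation x = record
    { to        = _∙ x
    ; from      = _∙ x ⁻¹
    ; to-cong   = ∙-congʳ
    ; from-cong = ∙-congʳ
    ; inverse   = (λ {y} eq → trans (∙-congʳ eq) (//-rightDividesˡ x y))
                , (λ {y} eq → trans (∙-congʳ eq) (//-rightDividesʳ x y))
    }

  module _ (α : Automorphism G) {x : Carrier} (xα≈x⁻¹ : x ^ α ≈ x ⁻¹) where

    open Automorphism α using (⟦⟧-cong; ∙-homo; ⁻¹-homo)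

    -- Inverting `y ∙ x` brings `x ⁻¹` to the front, and `α` turns it back into `x`; hence `x`
    -- stands on both sides, rather than `x ⁻¹` on one of them.
    translate-difference : ∀ y h →
      ((y ∙ x) ⁻¹) ^ α ∙ (h ∙ x) ≈ x ∙ ((y ⁻¹) ^ α ∙ h) ∙ x
    translate-difference y h = begin
      ((y ∙ x) ⁻¹) ^ α ∙ (h ∙ x)          ≈⟨ assoc _ h x ⟨
      ((y ∙ x) ⁻¹) ^ α ∙ h ∙ x            ≈⟨ ∙-congʳ (∙-congʳ (⟦⟧-cong (⁻¹-anti-homo-∙ y x))) ⟩
      (x ⁻¹ ∙ y ⁻¹) ^ α ∙ h ∙ x           ≈⟨ ∙-congʳ (∙-congʳ (∙-homo (x ⁻¹) (y ⁻¹))) ⟩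
      (x ⁻¹) ^ α ∙ (y ⁻¹) ^ α ∙ h ∙ x     ≈⟨ ∙-congʳ (∙-congʳ (∙-congʳ x⁻¹α≈x)) ⟩
      x ∙ (y ⁻¹) ^ α ∙ h ∙ x              ≈⟨ ∙-congʳ (assoc x _ h) ⟩
      x ∙ ((y ⁻¹) ^ α ∙ h) ∙ x            ∎
      where
      x⁻¹α≈x : (x ⁻¹) ^ α ≈ x
      x⁻¹α≈x = begin
        (x ⁻¹) ^ α   ≈⟨ ⁻¹-homo x ⟩
        (x ^ α) ⁻¹   ≈⟨ ⁻¹-cong xα≈x⁻¹ ⟩
        x ⁻¹ ⁻¹      ≈⟨ ⁻¹-involutive x ⟩
        x            ∎

    difference-resp : ∀ {p} (A : Subset G p) {y y′ h h′} → y ≈ y′ → h ≈ h′ →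
      (y ⁻¹) ^ α ∙ h ∈ A → (y′ ⁻¹) ^ α ∙ h′ ∈ A
    difference-resp A y≈y′ h≈h′ =
      Subset.resp A (∙-cong (⟦⟧-cong (⁻¹-cong y≈y′)) h≈h′)

    module _ {p} (S : Subset G p) where

      translate⁺ : ∀ y h → (y ⁻¹) ^ α ∙ h ∈ S →
        ((y ∙ x) ⁻¹) ^ α ∙ (h ∙ x) ∈ twoSided G x S
      translate⁺ y h yh∈S = _ , yh∈S , translate-difference y h

      -- A member of `twoSided G x S` comes with some `s` in `S`; cancelling `x` on the left and on
      -- the right identifies this `s` with the difference of `y` and `h`.
      translate⁻ : ∀ y h → ((y ∙ x) ⁻¹) ^ α ∙ (h ∙ x) ∈ twoSided G x S →
        (y ⁻¹) ^ α ∙ h ∈ S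
      translate⁻ y h (s , s∈S , eq) = Subset.resp S s≈ s∈S
        where
        s≈ : s ≈ (y ⁻¹) ^ α ∙ h
        s≈ = ∙-cancelˡ x _ _ (∙-cancelʳ x _ _
               (trans (sym eq) (translate-difference y h)))

      -- Each vertex `y` equals `y ∙ x ⁻¹ ∙ x`, so a difference of arbitrary vertices can be pulled
      -- back to `S`.
      translate⁻′ : ∀ y h → (y ⁻¹) ^ α ∙ h ∈ twoSided G x S →
        ((y ∙ x ⁻¹) ⁻¹) ^ α ∙ (h ∙ x ⁻¹) ∈ S
      translate⁻′ y h yh∈xSx = translate⁻ _ _
        (difference-resp (twoSided G x S)
          (sym (//-rightDividesˡ x y)) (sym (//-rightDividesˡ x h)) yh∈xSx)

      twoSided-isGeneralizedCayley :
        IsGeneralizedCayley G S α → IsGeneralizedCayley G (twoSided G x S) α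
      twoSided-isGeneralizedCayley isGC = record
        { α²≈id     = α²≈id
        ; loopless  = λ y yy∈xSx → loopless _ (translate⁻′ y y yy∈xSx)
        -- Pull back to `S`, swap there, and push forward again. The result concerns `y ∙ x ⁻¹ ∙ x`
        -- and `h ∙ x ⁻¹ ∙ x`, which `difference-resp` replaces by `y` and `h`.
        ; symmetric = λ y h hy∈xSx → difference-resp (twoSided G x S)
            (//-rightDividesˡ x y) (//-rightDividesˡ x h)
            (translate⁺ _ _ (symmetric _ _ (translate⁻′ h y hy∈xSx)))
        }
        where open IsGeneralizedCayley isGC

      -- Adjacency depends on the subset and `α` alone, so any `isGC′` will do.
      GC≅GC-twoSided :
        (isGC : IsGeneralizedCayley G S α)
        (isGC′ : IsGeneralizedCayley G (twoSided G x S) α) →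
        GC G S α isGC ≅ GC G (twoSided G x S) α isGC′
      GC≅GC-twoSided isGC isGC′ = record
        { bijection = rightTranslation x
        ; Adj⇔      = λ y h → mk⇔ (translate⁺ y h) (translate⁻ y h)
        }

theorem3p3 : ∀ {c ℓ p} (G : Group c ℓ) → IsFinite G → IsComplete G →
    (g : Group.Carrier G) → IsInvolution G g →
    (S : Subset G p) (isGC : IsGeneralizedCayley G S (σ G g)) →
    (x : Group.Carrier G) → x ∈ Ω G (σ G g) →
    Σ[ isGC′ ∈ IsGeneralizedCayley G (twoSided G x S) (σ G g) ]
    GC G S (σ G g) isGC ≅ GC G (twoSided G x S) (σ G g) isGC′
theorem3p3 G _ _ g _ S isGC x x∈Ω = isGC′ , GC≅GC-twoSided G α xα≈x⁻¹ S isGC isGC′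
  where
  α = σ G g
  -- The first half of membership in `Ω`: `α` inverts `x`, as the translation argument requires.
  xα≈x⁻¹ = proj₁ x∈Ω
  isGC′ = twoSided-isGeneralizedCayley G α xα≈x⁻¹ S isGC
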